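{- If $X$ is a nonempty topological space and $\Omega\neq\Omega_0$ is an arbitrary topological signature (i.e., $\Omega_n\neq\emptyset$ for some $n\ge1$), then the free Stone topological algebra $\overline{\Omega}_X\mathcal{S}t_\Omega$ is not profinite.
   Context: $\Omega=\biguplus_n\Omega_n$ is a topological signature. A Stone topological $\Omega$-algebra is a compact Hausdorff 0-dimensional space $A$ with continuous evaluation maps $\Omega_n\times A^n\to A$; $\mathcal{S}t_\Omega$ is the class of all of them. $\overline{\Omega}_X\mathcal{S}t_\Omega$ is the free Stone topological algebra over $X$: a Stone topological $\Omega$-algebra with a continuous map $\iota$ from $X$ whose image generates a dense subalgebra, such that every continuous map from $X$ into a Stone topological $\Omega$-algebra $T$ factors uniquely as $\hat\varphi\circ\iota$ with $\hat\varphi$ a continuous homomorphism. A topological algebra is profinite if it is compact and any two distinct elements are separated by a continuous homomorphism into a finite discrete $\Omega$-algebra. -}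

module Defs where

open import Level using (Level) renaming (suc to lsuc)
open import Data.Nat.Base using (ℕ)
open import Data.Fin.Base using (Fin)
open import Data.List.Base using (List)
open import Data.List.Relation.Unary.Any using (Any)
open import Data.Product.Base using (Σ-syntax; ∃-syntax; _×_; _,_; proj₁; proj₂)
open import Data.Vec.Base using (Vec; lookup; map)
open import Data.Vec.Relation.Unary.All using (All)
open import Data.Unit.Polymorphic.Base using (tt)
open import Function.Base using (_∘_)
open import Function.Bundles using (_↔_)
open import Relation.Binary.PropositionalEquality using (_≡_; _≢_; _≗_)
open import Relation.Unary using (Pred; _∈_; _⊆_; _≐_; _∩_; _≬_; _⊥_; _⊢_; ∁; ⋃; Satisfiable)
open import Relation.Unary.Polymorphic using (U)

private
  variable
    ℓ : Level

-- Subsets are predicates, so the family of open sets is required to be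
-- invariant under extensional equality _≐_.  The empty set is open as the
-- union of the empty family.
record TopologicalSpace (ℓ : Level) : Set (lsuc (lsuc ℓ)) where
  field
    Carrier  : Set ℓ
    Open     : Pred Carrier ℓ → Set (lsuc ℓ)
    Open-≐   : ∀ {P Q : Pred Carrier ℓ} → P ≐ Q → Open P → Open Q
    Open-U   : Open U
    Open-∩   : ∀ {P Q : Pred Carrier ℓ} → Open P → Open Q → Open (P ∩ Q)
    Open-⋃   : ∀ {I : Set ℓ} (P : I → Pred Carrier ℓ) →
               (∀ i → Open (P i)) → Open (⋃ I P)

open TopologicalSpace using (Carrier; Open)

Continuous : (X Y : TopologicalSpace ℓ) → (Carrier X → Carrier Y) → Set (lsuc ℓ)
Continuous {ℓ} X Y f = ∀ (V : Pred (Carrier Y) ℓ) → Open Y V → Open X (f ⊢ V)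

-- The product topology: every point of an open set has an open box around it
-- contained in the set.
infixr 2 _×ₜ_
_×ₜ_ : TopologicalSpace ℓ → TopologicalSpace ℓ → TopologicalSpace ℓ
_×ₜ_ {ℓ} X Y = record
  { Carrier = Carrier X × Carrier Y
  ; Open    = λ W → ∀ p → p ∈ W →
      Σ[ P ∈ Pred (Carrier X) ℓ ] Σ[ Q ∈ Pred (Carrier Y) ℓ ]
        Open X P × Open Y Q × p ∈ Box P Q × Box P Q ⊆ W
  ; Open-≐  = λ (P⊆Q , Q⊆P) oP p p∈Q →
      let A , B , oA , oB , p∈ , ⊆P = oP p (Q⊆P p∈Q)
      in  A , B , oA , oB , p∈ , λ q∈ → P⊆Q (⊆P q∈)
  ; Open-U  = λ p _ →
      U , U , X.Open-U , Y.Open-U , (tt , tt) , λ _ → tt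
  ; Open-∩  = λ oP oQ p (p∈P , p∈Q) →
      let A , B , oA , oB , (a , b) , ⊆P = oP p p∈P
          C , D , oC , oD , (c , d) , ⊆Q = oQ p p∈Q
      in  A ∩ C , B ∩ D , X.Open-∩ oA oC , Y.Open-∩ oB oD , ((a , c) , (b , d)) ,
          λ ((a , c) , (b , d)) → ⊆P (a , b) , ⊆Q (c , d)
  ; Open-⋃  = λ P oP p (i , p∈Pi) →
      let A , B , oA , oB , p∈ , ⊆P = oP i p p∈Pi
      in  A , B , oA , oB , p∈ , λ q∈ → i , ⊆P q∈
  }
  where
  module X = TopologicalSpace X
  module Y = TopologicalSpace Y
  Box : Pred (Carrier X) ℓ → Pred (Carrier Y) ℓ → Pred (Carrier X × Carrier Y) ℓ
  Box P Q (x , y) = x ∈ P × y ∈ Q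

infixl 8 _^ₜ_
_^ₜ_ : TopologicalSpace ℓ → ℕ → TopologicalSpace ℓ
_^ₜ_ {ℓ} X n = record
  { Carrier = Vec (Carrier X) n
  ; Open    = λ W → ∀ v → v ∈ W →
      Σ[ P ∈ (Fin n → Pred (Carrier X) ℓ) ]
        (∀ i → Open X (P i)) × v ∈ Box P × Box P ⊆ W
  ; Open-≐  = λ (P⊆Q , Q⊆P) oP v v∈Q →
      let A , oA , v∈ , ⊆P = oP v (Q⊆P v∈Q)
      in  A , oA , v∈ , λ w∈ → P⊆Q (⊆P w∈)
  ; Open-U  = λ v _ → (λ _ → U) , (λ _ → X.Open-U) , (λ _ → tt) , λ _ → tt
  ; Open-∩  = λ oP oQ v (v∈P , v∈Q) →
      let A , oA , a , ⊆P = oP v v∈P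
          B , oB , b , ⊆Q = oQ v v∈Q
      in  (λ i → A i ∩ B i) , (λ i → X.Open-∩ (oA i) (oB i)) , (λ i → a i , b i) ,
          λ w∈ → ⊆P (proj₁ ∘ w∈) , ⊆Q (proj₂ ∘ w∈)
  ; Open-⋃  = λ P oP v (i , v∈Pi) →
      let A , oA , v∈ , ⊆P = oP i v v∈Pi
      in  A , oA , v∈ , λ w∈ → i , ⊆P w∈
  }
  where
  module X = TopologicalSpace X
  Box : (Fin n → Pred (Carrier X) ℓ) → Pred (Vec (Carrier X) n) ℓ
  Box P v = ∀ i → lookup v i ∈ P i

Compact : TopologicalSpace ℓ → Set (lsuc ℓ)
Compact {ℓ} X =
  ∀ {I : Set ℓ} (P : I → Pred (Carrier X) ℓ) → (∀ i → Open X (P i)) →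
  (∀ x → ∃[ i ] x ∈ P i) →
  Σ[ is ∈ List I ] (∀ x → Any (λ i → x ∈ P i) is)

Hausdorff : TopologicalSpace ℓ → Set (lsuc ℓ)
Hausdorff {ℓ} X =
  ∀ (x y : Carrier X) → x ≢ y →
  Σ[ P ∈ Pred (Carrier X) ℓ ] Σ[ Q ∈ Pred (Carrier X) ℓ ]
    Open X P × Open X Q × x ∈ P × y ∈ Q × P ⊥ Q

Clopen : (X : TopologicalSpace ℓ) → Pred (Carrier X) ℓ → Set (lsuc ℓ)
Clopen X P = Open X P × Open X (∁ P)

ZeroDimensional : TopologicalSpace ℓ → Set (lsuc ℓ)
ZeroDimensional {ℓ} X =
  ∀ (P : Pred (Carrier X) ℓ) → Open X P → ∀ x → x ∈ P →
  Σ[ Q ∈ Pred (Carrier X) ℓ ] Clopen X Q × x ∈ Q × Q ⊆ P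

Discrete : TopologicalSpace ℓ → Set (lsuc ℓ)
Discrete {ℓ} X = ∀ (P : Pred (Carrier X) ℓ) → Open X P

Dense : (X : TopologicalSpace ℓ) → Pred (Carrier X) ℓ → Set (lsuc ℓ)
Dense {ℓ} X D = ∀ (P : Pred (Carrier X) ℓ) → Open X P → Satisfiable P → P ≬ D

Finite : Set ℓ → Set ℓ
Finite A = ∃[ n ] (A ↔ Fin n)

-- Ω n is the space of n-ary operation symbols; Ω itself is the topological sum.
TopologicalSignature : (ℓ : Level) → Set (lsuc (lsuc ℓ))
TopologicalSignature ℓ = ℕ → TopologicalSpace ℓ

record TopologicalAlgebra {ℓ : Level} (Ω : TopologicalSignature ℓ) : Set (lsuc (lsuc ℓ)) where
  field
    space      : TopologicalSpace ℓ
    eval       : ∀ n → Carrier (Ω n) × Vec (Carrier space) n → Carrier space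
    continuous : ∀ n → Continuous (Ω n ×ₜ space ^ₜ n) space (eval n)

  ∣_∣ : Set ℓ
  ∣_∣ = Carrier space

open TopologicalAlgebra using (space; eval; ∣_∣)

module _ {ℓ : Level} {Ω : TopologicalSignature ℓ} where

  record IsStone (A : TopologicalAlgebra Ω) : Set (lsuc ℓ) where
    field
      compact         : Compact (space A)
      hausdorff       : Hausdorff (space A)
      zeroDimensional : ZeroDimensional (space A)

  IsHomomorphism : (A B : TopologicalAlgebra Ω) → (∣ A ∣ → ∣ B ∣) → Set ℓ
  IsHomomorphism A B h =
    ∀ n (w : Carrier (Ω n)) (v : Vec ∣ A ∣ n) →
    h (eval A n (w , v)) ≡ eval B n (w , map h v)

  IsContinuousHomomorphism : (A B : TopologicalAlgebra Ω) → (∣ A ∣ → ∣ B ∣) → Set (lsuc ℓ)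
  IsContinuousHomomorphism A B h = IsHomomorphism A B h × Continuous (space A) (space B) h

  data Generated (A : TopologicalAlgebra Ω) {X : Set ℓ} (ι : X → ∣ A ∣) : Pred ∣ A ∣ ℓ where
    gen : ∀ x → Generated A ι (ι x)
    op  : ∀ n (w : Carrier (Ω n)) (v : Vec ∣ A ∣ n) →
          All (Generated A ι) v → Generated A ι (eval A n (w , v))

  Profinite : TopologicalAlgebra Ω → Set (lsuc (lsuc ℓ))
  Profinite A =
    Compact (space A) ×
    (∀ (x y : ∣ A ∣) → x ≢ y →
     Σ[ B ∈ TopologicalAlgebra Ω ] Finite ∣ B ∣ × Discrete (space B) ×
     Σ[ h ∈ (∣ A ∣ → ∣ B ∣) ] IsContinuousHomomorphism A B h × h x ≢ h y)

record FreeStoneAlgebra {ℓ : Level} (Ω : TopologicalSignature ℓ) (X : TopologicalSpace ℓ)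
       : Set (lsuc (lsuc ℓ)) where
  field
    algebra      : TopologicalAlgebra Ω
    isStone      : IsStone algebra
    ι            : Carrier X → ∣ algebra ∣
    ι-continuous : Continuous X (space algebra) ι
    ι-dense      : Dense (space algebra) (Generated algebra ι)
    universal    : ∀ (T : TopologicalAlgebra Ω) → IsStone T →
                   ∀ (φ : Carrier X → ∣ T ∣) → Continuous X (space T) φ →
                   Σ[ φ̂ ∈ (∣ algebra ∣ → ∣ T ∣) ]
                     IsContinuousHomomorphism algebra T φ̂ ×
                     φ̂ ∘ ι ≗ φ ×
                     (∀ (ψ : ∣ algebra ∣ → ∣ T ∣) →
                      IsContinuousHomomorphism algebra T ψ → ψ ∘ ι ≗ φ → ψ ≗ φ̂)

{-# OPTIONS --safe #-}
-- If a compact algebra is profinite, two applications of compactness show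
-- that membership in a given clopen set C is decided by finitely many
-- homomorphisms h into finite algebras.  Along an orbit a, g a, g (g a), … of a
-- derived unary operation g, the pigeonhole principle makes the values of all
-- these h eventually periodic, so C is visited in an eventually periodic way.
--
-- On the other hand, let T be the one-point compactification of ℕ × (ℕ ∪ {∞}),
-- and let every operation of positive arity act on its first argument by
--   (k + 1 , j) ↦ (k , j),  (0 , j) ↦ (j + 1 , j + 1),  (0 , ∞) ↦ ∞,  ∞ ↦ ∞.
-- The orbit of (0 , 0) visits the clopen set {0} × (ℕ ∪ {∞}) with strictly
-- increasing gaps.  Pulling this set back to the free algebra along the
-- homomorphism mapping X to (0 , 0) contradicts profiniteness.
module Submission where

open import Defs
open import Level using (Level) renaming (suc to lsuc)
open import Data.Fin.Base as Fin using (Fin; combine; toℕ)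
open import Data.Fin.Properties using (combine-injective; pigeonhole)
open import Data.List.Base using (List; []; _∷_; _++_; concatMap)
import Data.List.Base as List
open import Data.List.Relation.Unary.All as All using (All; []; _∷_)
open import Data.List.Relation.Unary.All.Properties using (All¬⇒¬Any)
open import Data.List.Relation.Unary.Any as Any using (Any; here; there)
open import Data.List.Relation.Unary.Any.Properties using (++⁺ˡ; ++⁺ʳ; concatMap⁺; map⁺)
open import Data.Maybe.Base using (Maybe; just; nothing)
open import Data.Nat.Base using (ℕ; zero; suc; _+_; _*_; _≤_; _<_; _≥_; z≤n; s≤s)
open import Data.Nat.GeneralisedArithmetic using (fold; fold-+)
open import Data.Nat.Properties using (+-assoc; +-comm; +-suc; <-irrefl; m≤n⇒∃[o]m+o≡n; m≤n⇒m≤1+n; m≤m+n; m≤n+m; m≤n⇒m<n∨m≡n; n<1+n; ≤-trans; _<?_; ≮⇒≥)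
open import Data.Product.Base using (Σ-syntax; ∃-syntax; _×_; _,_; proj₁; proj₂)
open import Data.Sum.Base as Sum using (_⊎_; inj₁; inj₂; [_,_]′)
open import Data.Unit.Polymorphic.Base using (tt)
open import Data.Vec.Base using (Vec; []; _∷_; lookup; replicate)
open import Data.Vec.Properties using (map-replicate)
open import Function.Base using (_∘_; const)
open import Function.Bundles using (module Injection)
open import Function.Properties.Inverse using (↔⇒↣)
open import Relation.Binary.PropositionalEquality using (_≡_; _≢_; refl; sym; trans; cong; subst; subst₂; module ≡-Reasoning)
open import Relation.Nullary.Decidable using (yes; no; toSum; decidable-stable)
open import Relation.Nullary.Negation.Core using (¬_; contradiction)
open import Relation.Unary using (Pred; _∈_; _∉_; _⊢_; Decidable)
open import Relation.Unary.Polymorphic using (U)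

open TopologicalSpace using (Carrier; Open; Open-≐; Open-U; Open-∩; Open-⋃)
open TopologicalAlgebra using (space; eval; ∣_∣)

private
  variable
    ℓ : Level

-- Open sets and compactness outside an open set.

module _ (X : TopologicalSpace ℓ) where

  -- `const P` is the union of copies of the whole space indexed by the proofs of `P`, which avoids
  -- deciding `P`.
  Open-const : (P : Set ℓ) → Open X (const P)
  Open-const P = Open-≐ X (proj₁ , λ p → p , tt) (Open-⋃ X {I = P} (λ _ → U) (λ _ → Open-U X))

  Open-All : {I : Set ℓ} (P : I → Pred (Carrier X) ℓ) → (∀ i → Open X (P i)) →
             ∀ is → Open X (λ x → All (λ i → x ∈ P i) is)
  Open-All P oP []       = Open-≐ X ((λ _ → []) , λ _ → tt) (Open-U X)
  Open-All P oP (i ∷ is) =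
    Open-≐ X ((λ (p , ps) → p ∷ ps) , λ where (p ∷ ps) → p , ps)
           (Open-∩ X (oP i) (Open-All P oP is))

  -- This is compactness of the closed complement of `D`: adjoin `D` to the cover under the index
  -- `nothing`, then drop that index from the finite subcover. The disjunction keeps the statement
  -- constructive.
  compact-outside-open : Compact X → {D : Pred (Carrier X) ℓ} → Open X D →
    {I : Set ℓ} (P : I → Pred (Carrier X) ℓ) → (∀ i → Open X (P i)) →
    (∀ x → x ∈ D ⊎ ∃[ i ] x ∈ P i) →
    Σ[ is ∈ List I ] (∀ x → x ∈ D ⊎ Any (λ i → x ∈ P i) is)
  compact-outside-open compact {D} oD {I} P oP covers =
    List.catMaybes is , λ x → select (is-covers x)
    where
    P′ : Maybe I → Pred (Carrier X) ℓ
    P′ nothing  = D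
    P′ (just i) = P i

    oP′ : ∀ i → Open X (P′ i)
    oP′ nothing  = oD
    oP′ (just i) = oP i

    subcover = compact P′ oP′
      (λ x → [ (nothing ,_) , (λ (i , p) → just i , p) ]′ (covers x))
    is        = proj₁ subcover
    is-covers = proj₂ subcover

    select : ∀ {x is} → Any (λ i → x ∈ P′ i) is →
             x ∈ D ⊎ Any (λ i → x ∈ P i) (List.catMaybes is)
    select {is = nothing ∷ _} (here p)  = inj₁ p
    select {is = nothing ∷ _} (there p) = select p
    select {is = just _ ∷ _}  (here p)  = inj₂ (here p)
    select {is = just _ ∷ _}  (there p) = Sum.map₂ there (select p)

-- Finite homomorphic images

module _ {Ω : TopologicalSignature ℓ} where

  -- Repeating one argument turns an operation of any arity into a derived unary one, whose orbits
  -- homomorphisms preserve.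
  diagonal : (A : TopologicalAlgebra Ω) → ∀ n → Carrier (Ω n) → ∣ A ∣ → ∣ A ∣
  diagonal A n w a = eval A n (w , replicate n a)

  diagonal-homomorphic : ∀ {A B h} → IsHomomorphism A B h →
    ∀ n w a → h (diagonal A n w a) ≡ diagonal B n w (h a)
  diagonal-homomorphic {A} {B} {h} hom n w a =
    trans (hom n w (replicate n a)) (cong (λ v → eval B n (w , v)) (map-replicate h a n))

  record FiniteImage (A : TopologicalAlgebra Ω) : Set (lsuc (lsuc ℓ)) where
    field
      target     : TopologicalAlgebra Ω
      finite     : Finite ∣ target ∣
      discrete   : Discrete (space target)
      hom        : ∣ A ∣ → ∣ target ∣
      continuous : IsContinuousHomomorphism A target hom

    Open-fibre : ∀ a → Open (space A) (λ b → hom b ≡ hom a)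
    Open-fibre a = proj₂ continuous (_≡ hom a) (discrete _)

  open FiniteImage using (hom)

  module _ {A : TopologicalAlgebra Ω} where

    Identified : List (FiniteImage A) → ∣ A ∣ → ∣ A ∣ → Set _
    Identified hs a b = All (λ h → hom h a ≡ hom h b) hs

    identified-diagonal : ∀ {hs a b} n w → Identified hs a b →
      Identified hs (diagonal A n w a) (diagonal A n w b)
    identified-diagonal n w = All.map λ {h} ha≡hb →
      let open FiniteImage h using (target; continuous)
          diag = diagonal-homomorphic {A} {target} (proj₁ continuous) n w
      in  trans (diag _) (trans (cong (diagonal target n w) ha≡hb) (sym (diag _)))

    identified-fold : ∀ {hs a b} n w m → Identified hs a b →
      Identified hs (fold a (diagonal A n w) m) (fold b (diagonal A n w) m)
    identified-fold n w zero    e = e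
    identified-fold n w (suc m) e = identified-diagonal n w (identified-fold n w m e)

    -- `combine` packs the values under all homomorphisms into one number. The empty list identifies
    -- everything, hence a single code.
    finite-code : ∀ hs → ∃[ M ] Σ[ code ∈ (∣ A ∣ → Fin M) ]
                  (∀ {a b} → code a ≡ code b → Identified hs a b)
    finite-code []       = 1 , const Fin.zero , λ _ → []
    finite-code (h ∷ hs) with FiniteImage.finite h | finite-code hs
    ... | N , fin | M , code , sound =
      N * M , (λ a → combine (to (hom h a)) (code a)) , λ eq →
        let eq₁ , eq₂ = combine-injective _ _ _ _ eq
        in  injective eq₁ ∷ sound eq₂
      where open Injection (↔⇒↣ fin) using (to; injective)

    identified-pair : ∀ hs (p : ℕ → ∣ A ∣) →
                      ∃[ i ] ∃[ j ] (i < j × Identified hs (p i) (p j))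
    identified-pair hs p =
      let M , code , sound  = finite-code hs
          -- The `M + 1` terms `p 0`, ..., `p M` share `M` codes.
          i , j , i<j , eq = pigeonhole (n<1+n M) (code ∘ p ∘ toℕ)
      in  toℕ i , toℕ j , i<j , sound eq

    -- Clopen sets decided by finitely many finite images.

    module _ (profinite : Profinite A) {C : Pred ∣ A ∣ ℓ}
             (clopen : Clopen (space A) C) (C? : Decidable C) where

      private
        In Out : Set ℓ
        In  = Σ[ a ∈ ∣ A ∣ ] a ∈ C
        Out = Σ[ b ∈ ∣ A ∣ ] b ∉ C

        separation : (a : In) (b : Out) →
                     Σ[ h ∈ FiniteImage A ] hom h (proj₁ a) ≢ hom h (proj₁ b)
        separation (a , a∈C) (b , b∉C) =
          let B , fin , disc , h , cont , ha≢hb =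
                proj₂ profinite a b (λ { refl → b∉C a∈C })
          in  record { target = B ; finite = fin ; discrete = disc
                     ; hom = h ; continuous = cont } , ha≢hb

        image : In → Out → FiniteImage A
        image a b = proj₁ (separation a b)

        -- For fixed `a`, the fibre of `image a b` through `b` is an open neighbourhood of `b`.
        -- These fibres cover the complement of `C`, and compactness keeps finitely many.
        outer : (a : In) → Σ[ bs ∈ List Out ]
          (∀ y → y ∈ C ⊎ Any (λ b → hom (image a b) y ≡ hom (image a b) (proj₁ b)) bs)
        outer a = compact-outside-open (space A) (proj₁ profinite) (proj₁ clopen) _
          (λ b → FiniteImage.Open-fibre (image a b) (proj₁ b))
          (λ y → Sum.map₂ (λ y∉C → (y , y∉C) , refl) (toSum (C? y)))

        Near : In → Pred ∣ A ∣ ℓ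
        Near a x = All (λ b → hom (image a b) x ≡ hom (image a b) (proj₁ a)) (proj₁ (outer a))

        -- `Near a` is a finite intersection of open fibres through `a`, so these sets cover `C`.
        -- Compactness is now applied outside the open complement of `C`.
        inner : Σ[ as ∈ List In ] (∀ x → x ∉ C ⊎ Any (λ a → x ∈ Near a) as)
        inner = compact-outside-open (space A) (proj₁ profinite) (proj₂ clopen) Near
          (λ a → Open-All (space A) _
                   (λ b → FiniteImage.Open-fibre (image a b) (proj₁ a)) (proj₁ (outer a)))
          (λ x → Sum.swap (Sum.map₁ (λ x∈C → (x , x∈C) , All.universal (λ _ → refl) _)
                                    (toSum (C? x))))

        -- For some kept `b`, the image `image a b` gives `y` the value of `b` and `x` the value of
        -- `a`, and these differ.
        near-separated : ∀ {x y} a → x ∈ Near a → y ∉ C →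
          Any (λ b → hom (image a b) x ≢ hom (image a b) y) (proj₁ (outer a))
        near-separated {x} {y} a near y∉C with proj₂ (outer a) y
        ... | inj₁ y∈C   = contradiction y∈C y∉C
        ... | inj₂ close = go near close
          where
          go : ∀ {bs} → All (λ b → hom (image a b) x ≡ hom (image a b) (proj₁ a)) bs →
               Any (λ b → hom (image a b) y ≡ hom (image a b) (proj₁ b)) bs →
               Any (λ b → hom (image a b) x ≢ hom (image a b) y) bs
          go (x≡ ∷ _)  (here {x = b} y≡) = here λ x≡y →
            proj₂ (separation a b) (trans (sym x≡) (trans x≡y y≡))
          go (_ ∷ x≡s) (there y≡s)       = there (go x≡s y≡s)

      -- If `y` were outside `C`, some `Near a` containing `x` would yield a listed image separating
      -- `x` from `y`. Decidability of `C` turns this refutation into membership.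
      deciding-images : Σ[ hs ∈ List (FiniteImage A) ]
        (∀ {x y} → Identified hs x y → x ∈ C → y ∈ C)
      deciding-images = hs , λ {x} {y} same x∈C → decidable-stable (C? y) λ y∉C →
        [ (λ x∉C → x∉C x∈C)
        , (λ near → All¬⇒¬Any {P = λ h → hom h x ≢ hom h y} (All.map (λ eq neq → neq eq) same)
            (concatMap⁺ (λ a → List.map (image a) (proj₁ (outer a)))
              (Any.map (λ {a} x∈ → map⁺ (near-separated a x∈ y∉C)) near)))
        ]′ (proj₂ inner x)
        where
        hs : List (FiniteImage A)
        hs = concatMap (λ a → List.map (image a) (proj₁ (outer a))) (proj₁ inner)

      orbit-eventually-periodic : ∀ n w a → let p = fold a (diagonal A n w) in
        ∃[ i ] ∃[ j ] (i < j × (∀ m → p (m + i) ∈ C → p (m + j) ∈ C))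
      orbit-eventually-periodic n w a =
        let hs , decides      = deciding-images
            i , j , i<j , eq = identified-pair hs (fold a g)
        in  i , j , i<j , λ m → decides
              -- By `fold-+`, `p (m + i)` is the `m`-th iterate of `g` from `p i`, so the collision
              -- at `i` and `j` propagates along the orbit.
              (subst₂ (Identified hs) (sym (fold-+ a g m)) (sym (fold-+ a g m))
                      (identified-fold n w m eq))
        where
        g : ∣ A ∣ → ∣ A ∣
        g = diagonal A n w

-- The Stone space T

-- limit k and point k j are the points (k , ∞) and (k , j).
data Point (ℓ : Level) : Set ℓ where
  ∞     : Point ℓ
  limit : ℕ → Point ℓ
  point : ℕ → ℕ → Point ℓ

-- The compactification topology by neighbourhood conditions: every `point k j` is isolated, each
-- row converges to its limit, and whole rows converge to `∞`.
record OpenPoints (P : Pred (Point ℓ) ℓ) : Set (lsuc ℓ) where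
  field
    near-limit : ∀ k → limit k ∈ P → ∃[ N ] (∀ j → N ≤ j → point k j ∈ P)
    near-∞     : ∞ ∈ P → ∃[ K ] (∀ k → K ≤ k → limit k ∈ P × (∀ j → point k j ∈ P))

open OpenPoints

points : (ℓ : Level) → TopologicalSpace ℓ
points ℓ = record
  { Carrier = Point ℓ
  ; Open    = OpenPoints
  ; Open-≐  = λ (P⊆Q , Q⊆P) oP → record
      { near-limit = λ k q → let N , f = near-limit oP k (Q⊆P q) in N , λ j le → P⊆Q (f j le)
      ; near-∞     = λ q → let K , f = near-∞ oP (Q⊆P q) in
          K , λ k le → P⊆Q (proj₁ (f k le)) , λ j → P⊆Q (proj₂ (f k le) j) }
  ; Open-U  = record
      { near-limit = λ _ _ → 0 , λ _ _ → tt
      ; near-∞     = λ _ → 0 , λ _ _ → tt , λ _ → tt }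
  ; Open-∩  = λ oP oQ → record
      { near-limit = λ k (p , q) →
          let M , f = near-limit oP k p
              N , g = near-limit oQ k q
          in  M + N , λ j le → f j (≤-trans (m≤m+n M N) le) , g j (≤-trans (m≤n+m N M) le)
      ; near-∞     = λ (p , q) →
          let M , f = near-∞ oP p
              N , g = near-∞ oQ q
          in  M + N , λ k le →
                let a , b = f k (≤-trans (m≤m+n M N) le)
                    c , d = g k (≤-trans (m≤n+m N M) le)
                in  (a , c) , λ j → b j , d j }
  ; Open-⋃  = λ P oP → record
      { near-limit = λ k (i , p) →
          let N , f = near-limit (oP i) k p in N , λ j le → i , f j le
      ; near-∞     = λ (i , p) →
          let K , f = near-∞ (oP i) p
          in  K , λ k le → (i , proj₁ (f k le)) , λ j → i , proj₂ (f k le) j }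
  }

-- The member containing `∞` covers all rows from `K` on. In each earlier row the member containing
-- `limit k` leaves only a finite segment.
points-compact : Compact (points ℓ)
points-compact {ℓ} {I} P oP covers = i∞ ∷ proj₁ (rows K) , covered
  where
  i∞ = proj₁ (covers ∞)
  K  = proj₁ (near-∞ (oP i∞) (proj₂ (covers ∞)))

  Covered : Point ℓ → List I → Set ℓ
  Covered x = Any (λ i → x ∈ P i)

  segment : ∀ k N → Σ[ is ∈ List I ] (∀ j → j < N → Covered (point k j) is)
  segment k zero    = [] , λ _ ()
  segment k (suc N) =
    let i  , p = covers (point k N)
        is , f = segment k N
    in  i ∷ is , λ where
          j (s≤s j≤N) → [ (λ j<N → there (f j j<N)) , (λ { refl → here p }) ]′ (m≤n⇒m<n∨m≡n j≤N)

  row : ∀ k → Σ[ is ∈ List I ] (Covered (limit k) is × (∀ j → Covered (point k j) is))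
  row k =
    let i  , p = covers (limit k)
        N  , f = near-limit (oP i) k p
        is , g = segment k N
    in  i ∷ is , here p ,
        λ j → [ (λ j<N → there (g j j<N)) , (λ j≮N → here (f j (≮⇒≥ j≮N))) ]′ (toSum (j <? N))

  rows : ∀ K → Σ[ is ∈ List I ]
         (∀ k → k < K → Covered (limit k) is × (∀ j → Covered (point k j) is))
  rows zero    = [] , λ _ ()
  rows (suc K) =
    let is , p , q = row K
        js , f     = rows K
    in  is ++ js , λ where
          k (s≤s k≤K) →
            [ (λ k<K → ++⁺ʳ is (proj₁ (f k k<K)) , λ j → ++⁺ʳ is (proj₂ (f k k<K) j))
            , (λ { refl → ++⁺ˡ p , λ j → ++⁺ˡ (q j) })
            ]′ (m≤n⇒m<n∨m≡n k≤K)

  covered-row : ∀ k → Covered (limit k) (i∞ ∷ proj₁ (rows K)) ×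
                      (∀ j → Covered (point k j) (i∞ ∷ proj₁ (rows K)))
  covered-row k with k <? K
  ... | yes k<K = let p , q = proj₂ (rows K) k k<K in there p , λ j → there (q j)
  ... | no  k≮K =
    let p , q = proj₂ (near-∞ (oP i∞) (proj₂ (covers ∞))) k (≮⇒≥ k≮K)
    in  here p , λ j → here (q j)

  covered : ∀ x → Covered x (i∞ ∷ proj₁ (rows K))
  covered ∞           = here (proj₂ (covers ∞))
  covered (limit k)   = proj₁ (covered-row k)
  covered (point k j) = proj₂ (covered-row k) j

-- `Branch k N` and `Tail K` are the basic clopen neighbourhoods of `limit k` and `∞`. `Branch 0 0`
-- is the set whose visits by the orbit are observed.
data Branch {ℓ : Level} (k N : ℕ) : Pred (Point ℓ) ℓ where
  limit : Branch k N (limit k)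
  point : ∀ {j} → N ≤ j → Branch k N (point k j)

data Tail {ℓ : Level} (K : ℕ) : Pred (Point ℓ) ℓ where
  ∞     : Tail K ∞
  limit : ∀ {k} → K ≤ k → Tail K (limit k)
  point : ∀ {k j} → K ≤ k → Tail K (point k j)

singleton-clopen : ∀ k j → Clopen (points ℓ) (_≡ point k j)
singleton-clopen k j =
  record { near-limit = λ _ () ; near-∞ = λ () } ,
  record
    { near-limit = λ _ _ → suc j , λ { _ j<j refl → <-irrefl refl j<j }
    ; near-∞     = λ _ → suc k , λ _ k<k → (λ ()) , λ { _ refl → <-irrefl refl k<k } }

branch-clopen : ∀ k N → Clopen (points ℓ) (Branch k N)
branch-clopen k N =
  record
    { near-limit = λ { _ limit → N , λ _ → point }
    ; near-∞     = λ () } ,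
  record
    { near-limit = λ _ l∉ → 0 , λ { _ _ (point _) → l∉ limit }
    ; near-∞     = λ _ → suc k , λ _ k<k →
        (λ { limit → <-irrefl refl k<k }) , λ { _ (point _) → <-irrefl refl k<k } }

tail-clopen : ∀ K → Clopen (points ℓ) (Tail K)
tail-clopen K =
  record
    { near-limit = λ { _ (limit K≤k) → 0 , λ _ _ → point K≤k }
    ; near-∞     = λ _ → K , λ _ K≤k → limit K≤k , λ _ → point K≤k } ,
  record
    { near-limit = λ _ l∉ → 0 , λ { _ _ (point K≤k) → l∉ (limit K≤k) }
    ; near-∞     = λ ∞∉ → contradiction ∞ ∞∉ }

-- Of two distinct points, one has a singleton or a branch as a clopen neighbourhood missing the
-- other; that set and its complement separate them.
points-hausdorff : Hausdorff (points ℓ)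
points-hausdorff = separate
  where
  Separated : (x y : Point ℓ) → Set (lsuc ℓ)
  Separated {ℓ} x y = Σ[ P ∈ Pred (Point ℓ) ℓ ] Σ[ Q ∈ Pred (Point ℓ) ℓ ]
    OpenPoints P × OpenPoints Q × x ∈ P × y ∈ Q × (∀ {z} → ¬ (z ∈ P × z ∈ Q))

  by : {P : Pred (Point ℓ) ℓ} → Clopen (points ℓ) P → ∀ {x y} → x ∈ P → y ∉ P → Separated x y
  by (oP , o∁P) x∈P y∉P = _ , _ , oP , o∁P , x∈P , y∉P , λ (p , ¬p) → ¬p p

  by′ : {P : Pred (Point ℓ) ℓ} → Clopen (points ℓ) P → ∀ {x y} → x ∉ P → y ∈ P → Separated x y
  by′ (oP , o∁P) x∉P y∈P = _ , _ , o∁P , oP , x∉P , y∈P , λ (¬p , p) → ¬p p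

  separate : (x y : Point ℓ) → x ≢ y → Separated x y
  separate (point k j) y           x≢y = by (singleton-clopen k j) refl (x≢y ∘ sym)
  separate x           (point k j) x≢y = by′ (singleton-clopen k j) x≢y refl
  separate (limit k)   ∞           x≢y = by (branch-clopen k 0) limit λ ()
  separate (limit k)   (limit l)   x≢y = by (branch-clopen k 0) limit λ { limit → x≢y refl }
  separate ∞           (limit k)   x≢y = by′ (branch-clopen k 0) (λ ()) limit
  separate ∞           ∞           x≢y = contradiction refl x≢y

points-zeroDimensional : ZeroDimensional (points ℓ)
points-zeroDimensional P oP ∞ ∞∈P =
  let K , f = near-∞ oP ∞∈P
  in  Tail K , tail-clopen K , ∞ , λ where
        ∞           → ∞∈P
        (limit K≤k) → proj₁ (f _ K≤k)
        (point K≤k) → proj₂ (f _ K≤k) _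
points-zeroDimensional P oP (limit k) l∈P =
  let N , f = near-limit oP k l∈P
  in  Branch k N , branch-clopen k N , limit , λ where
        limit       → l∈P
        (point N≤j) → f _ N≤j
points-zeroDimensional P oP (point k j) p∈P =
  (_≡ point k j) , singleton-clopen k j , refl , λ { refl → p∈P }

branch₀? : Decidable (Branch {ℓ} 0 0)
branch₀? ∞                 = no λ ()
branch₀? (limit zero)      = yes limit
branch₀? (limit (suc _))   = no λ ()
branch₀? (point zero _)    = yes (point z≤n)
branch₀? (point (suc _) _) = no λ ()

-- The dynamics on T

step : Point ℓ → Point ℓ
step ∞                 = ∞
step (limit zero)      = ∞
step (limit (suc k))   = limit k
step (point zero j)    = point (suc j) (suc j)
step (point (suc k) j) = point k j

step-continuous : Continuous (points ℓ) (points ℓ) step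
step-continuous V oV = record
  { near-limit = λ where
      -- The critical case: row 0 is sent to the points `(j + 1 , j + 1)`, whose rows tend to
      -- infinity, so the images converge to `∞`.
      zero    ∞∈V → let K , f = near-∞ oV ∞∈V
                    in  K , λ j K≤j → proj₂ (f (suc j) (m≤n⇒m≤1+n K≤j)) (suc j)
      (suc k) l∈V → near-limit oV k l∈V
  ; near-∞ = λ ∞∈V → let K , f = near-∞ oV ∞∈V
                     -- The bound `suc K` compensates for `step` lowering the row by one and
                     -- excludes row 0.
                     in  suc K , λ { (suc k) (s≤s K≤k) → f k K≤k }
  }

step-descends : ∀ m k j → fold (point {ℓ} (m + k) j) step m ≡ point k j
step-descends zero    k j = refl
step-descends (suc m) k j = cong step
  (trans (cong (λ l → fold (point l j) step m) (sym (+-suc m k))) (step-descends m (suc k) j))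

orbit : ℕ → Point ℓ
orbit = fold (point 0 0) step

-- From `(0 , q)` the orbit jumps to `(q + 1 , q + 1)` and descends one row at a time. The case
-- `k = 0` is the next visit to row 0; for `k > 0` the orbit is still on its way down.
orbit-after : ∀ {t q} → orbit {ℓ} t ≡ point 0 q →
              ∀ m k → m + k ≡ suc q → orbit {ℓ} (m + suc t) ≡ point k (suc q)
orbit-after {ℓ} {t} {q} eq m k m+k≡ = begin
  orbit (m + suc t)                 ≡⟨ fold-+ (point 0 0) step m ⟩
  fold (step (orbit t)) step m      ≡⟨ cong (λ x → fold (step x) step m) eq ⟩
  fold (point (suc q) (suc q)) step m
    ≡⟨ cong (λ l → fold (point l (suc q)) step m) (sym m+k≡) ⟩
  fold (point (m + k) (suc q)) step m ≡⟨ step-descends m k (suc q) ⟩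
  point k (suc q)                   ∎
  where open ≡-Reasoning

-- The bound `q ≤ t` provides visits at arbitrarily late times.
orbit-returns : ∀ q → ∃[ t ] (q ≤ t × orbit {ℓ} t ≡ point 0 q)
orbit-returns zero    = 0 , z≤n , refl
orbit-returns (suc q) =
  let t , q≤t , eq = orbit-returns q
  in  suc q + suc t , m≤m+n (suc q) (suc t) , orbit-after eq (suc q) 0 (+-comm (suc q) 0)

orbit-aperiodic : ∀ {i j} → i < j →
  ¬ (∀ m → Branch 0 0 (orbit {ℓ} (m + i)) → Branch 0 0 (orbit {ℓ} (m + j)))
orbit-aperiodic {ℓ} {i} i<j periodic
  with d , refl ← m≤n⇒∃[o]m+o≡n i<j
  -- Here `j` is `suc i + d`. The visit to `(0 , d + i)` happens at a time `t ≥ i`, and the next gap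
  -- `d + i + 2` exceeds the shift `d + 1`: after the shift the orbit is in row `i + 1`.
  with t , q≤t , eq ← orbit-returns {ℓ} (d + i)
  with m , refl ← m≤n⇒∃[o]m+o≡n (≤-trans (m≤n+m i d) q≤t)
  = absurd (subst (Branch 0 0) later (periodic m (subst (Branch 0 0) (sym now) (point z≤n))))
  where
  open ≡-Reasoning

  now : orbit (m + i) ≡ point 0 (d + i)
  now = trans (cong orbit (+-comm m i)) eq

  later : orbit (m + (suc i + d)) ≡ point (suc i) (suc (d + i))
  later = begin
    orbit (m + (suc i + d))   ≡⟨ cong orbit (+-assoc m (suc i) d) ⟨
    orbit (m + suc i + d)     ≡⟨ cong orbit (+-comm (m + suc i) d) ⟩
    orbit (d + (m + suc i))   ≡⟨ cong (λ n → orbit (d + n)) (+-suc m i) ⟩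
    orbit (d + suc (m + i))   ≡⟨ orbit-after now d (suc i) (+-suc d i) ⟩
    point (suc i) (suc (d + i)) ∎

  absurd : ∀ {k j} → ¬ Branch 0 0 (point {ℓ} (suc k) j)
  absurd ()

-- The algebra structure on T.

module _ (Ω : TopologicalSignature ℓ) where

  stepAlgebra : TopologicalAlgebra Ω
  stepAlgebra = record
    { space      = points ℓ
    ; eval       = evaluate
    ; continuous = evaluate-continuous
    }
    where
    evaluate : ∀ n → Carrier (Ω n) × Vec (Point ℓ) n → Point ℓ
    -- Constants get the default value `∞`. Other values depend only on the first argument, so
    -- evaluation is continuous for every topology on the symbols.
    evaluate zero    _           = ∞
    evaluate (suc n) (_ , x ∷ _) = step x

    evaluate-continuous : ∀ n → Continuous (Ω n ×ₜ points ℓ ^ₜ n) (points ℓ) (evaluate n)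
    evaluate-continuous zero V oV _ ∞∈V =
      U , U , Open-U (Ω 0) , Open-U (points ℓ ^ₜ 0) , (tt , tt) , λ _ → ∞∈V
    evaluate-continuous (suc n) V oV (_ , x ∷ v) x∈V =
      U , (λ u → lookup u Fin.zero ∈ step ⊢ V) , Open-U (Ω (suc n)) ,
      (λ u u∈V → (λ { Fin.zero → step ⊢ V ; (Fin.suc _) → U }) ,
        (λ { Fin.zero → step-continuous V oV ; (Fin.suc _) → Open-U (points ℓ) }) ,
        (λ { Fin.zero → u∈V ; (Fin.suc _) → tt }) ,
        λ w∈ → w∈ Fin.zero) ,
      (tt , x∈V) , λ { {_ , _ ∷ _} (_ , y∈V) → y∈V }

  stepAlgebra-isStone : IsStone stepAlgebra
  stepAlgebra-isStone = record
    { compact         = points-compact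
    ; hausdorff       = points-hausdorff
    ; zeroDimensional = points-zeroDimensional
    }

theorem4p18 : ∀ {ℓ : Level} (Ω : TopologicalSignature ℓ) (X : TopologicalSpace ℓ) →
    TopologicalSpace.Carrier X →
    (∃[ n ] (n ≥ 1 × TopologicalSpace.Carrier (Ω n))) →
    (F : FreeStoneAlgebra Ω X) →
    ¬ Profinite (FreeStoneAlgebra.algebra F)
theorem4p18 {ℓ} Ω X x (n@(suc _) , _ , w) F profinite =
  let i , j , i<j , periodic = orbit-eventually-periodic {A = algebra} profinite C-clopen C? n w (ι x)
  in  orbit-aperiodic i<j λ m →
        subst (Branch 0 0) (φ̂-orbit (m + j)) ∘ periodic m ∘
        subst (Branch 0 0) (sym (φ̂-orbit (m + i)))
  where
  open FreeStoneAlgebra F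

  extension = universal (stepAlgebra Ω) (stepAlgebra-isStone Ω)
    -- The preimage of `V` under a constant map is a constant predicate, open without a case split
    -- on `V (point 0 0)`.
    (const (point 0 0)) (λ V _ → Open-const X (V (point 0 0)))
  φ̂        = proj₁ extension
  φ̂-hom    = proj₁ (proj₁ (proj₂ extension))
  φ̂-cont   = proj₂ (proj₁ (proj₂ extension))
  φ̂-ι      = proj₁ (proj₂ (proj₂ extension))

  p : ℕ → ∣ algebra ∣
  p = fold (ι x) (diagonal algebra n w)

  -- Since the arity is a successor, the diagonal operation of `stepAlgebra Ω` computes to `step`.
  φ̂-orbit : ∀ t → φ̂ (p t) ≡ orbit t
  φ̂-orbit zero    = φ̂-ι x
  φ̂-orbit (suc t) = trans (diagonal-homomorphic {A = algebra} {B = stepAlgebra Ω} φ̂-hom n w (p t))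
                          (cong step (φ̂-orbit t))

  C : Pred ∣ algebra ∣ ℓ
  C = φ̂ ⊢ Branch 0 0

  C-clopen : Clopen (space algebra) C
  C-clopen = φ̂-cont _ (proj₁ (branch-clopen 0 0)) , φ̂-cont _ (proj₂ (branch-clopen 0 0))

  C? : Decidable C
  C? a = branch₀? (φ̂ a)
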